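{- The cycle-free fragments of G3s + $(\Box\mathrm{Cut})$, G3s + (Cut) and G3s are identical: a sequent has a prehistoric-cycle-free proof in one of these three systems if and only if it has one in each of the others.
   Context: S4 formulas: $A ::= \bot \mid P \mid A_0\to A_1 \mid \Box A$ ($P$ atomic). Sequents $\Gamma\supset\Delta$ use finite multisets; $\Box\Gamma:=\{\Box C\mid C\in\Gamma\}$. G3s rules: (Ax) $P,\Gamma\supset\Delta,P$ ($P$ atomic); $(\bot\supset)$ $\bot,\Gamma\supset\Delta$; $(\to\supset)$ from $\Gamma\supset\Delta,A$ and $B,\Gamma\supset\Delta$ infer $A\to B,\Gamma\supset\Delta$; $(\supset\to)$ from $A,\Gamma\supset\Delta,B$ infer $\Gamma\supset\Delta,A\to B$; $(\Box\supset)$ from $A,\Box A,\Gamma\supset\Delta$ infer $\Box A,\Gamma\supset\Delta$; $(\supset\Box)$ from $\Box\Gamma\supset A$ infer $\Gamma',\Box\Gamma\supset\Delta',\Box A$. (Cut): from $\Gamma\supset\Delta,A$ and $A,\Gamma\supset\Delta$ infer $\Gamma\supset\Delta$. $(\Box\mathrm{Cut})$: from $\Gamma\supset\Delta,\Box A,\Box B$ and $\Gamma\supset\Delta,\Box(A\to B),\Box B$ infer $\Gamma\supset\Delta,\Box B$. The system G3s + $(\Box\mathrm{Cut})$ is G3s with the rule $(\Box\mathrm{Cut})$ added; G3s + (Cut) is G3s with (Cut) added. In a rule instance, formulas of $\Gamma,\Delta,\Box\Gamma$ repeated in premise(s) and conclusion are side formulas; $\Gamma',\Delta'$ (and $\Gamma,\Delta$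 in axioms) are weakening formulas; the distinguished new formula of the conclusion is principal and the distinguished formulas of the premises are active. Correspondence of symbol occurrences: a symbol occurrence in a side formula of a premise directly corresponds to the same occurrence in the conclusion; an active formula of a premise directly corresponds to the topmost occurrence of that formula as a subformula of the principal formula, with its symbol occurrences corresponding accordingly; in (Cut) the two active occurrences of the cut formula (and their symbols) correspond; in $(\Box\mathrm{Cut})$ the outermost $\Box$'s of $\Box A$, $\Box(A\to B)$ and all occurrences of $\Box B$ correspond, the two occurrences of the subformula $A$ correspond symbolwise, and the occurrences of the subformula $B$ correspond symbolwise. Correspondence is the reflexive, symmetric, transitive closure; a family is an equivalence class of $\Box$-occurrences. $i\prec j$ (prehistoric relation) if some $(\supset\Box)$ rule whose principal $\Box A$ has its outermost $\Box$ in family $j$ has a premise containing a $\Box$-occurrence of family $i$. A prehistoric cycle is $i_0\prec\cdots\prec i_{n-1}\prec i_0$ ($n\ge1$); a proof is prehistoric-cycle-free if it has none. The cycle-free fragment of a system is the set of sequents having a prehistoric-cycle-free proof in that system. (For cut-free G3s proofs, restricting $\prec$ to families introduced by $(\supset\Box)$ rules yields the same cycles, since other families have no prehistoric predecessors.) -}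

module Defs where

open import Data.List.Base using (List; []; _∷_; _++_; map)
open import Data.List.Membership.Propositional using (_∈_)
open import Data.List.Relation.Binary.Permutation.Propositional using (_↭_)
open import Data.List.Relation.Binary.Permutation.Propositional.Properties
  using (Any-resp-↭)
open import Data.List.Relation.Unary.All as All using (All; []; _∷_)
open import Data.List.Relation.Unary.Any using (Any; here; there)
open import Data.List.Relation.Unary.Any.Properties using (++⁺ʳ)
open import Data.Nat.Base using (ℕ)
open import Data.Product.Base using (Σ-syntax; ∃-syntax; _×_; _,_)
open import Level using (0ℓ)
open import Relation.Binary.Construct.Closure.Equivalence using (EqClosure)
open import Relation.Binary.Construct.Closure.Transitive using (TransClosure)
open import Relation.Binary.PropositionalEquality.Core using (refl)
open import Relation.Nullary.Negation.Core using (¬_)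
open import Relation.Unary using (Pred)

infix  9 □_
infixr 8 _⇒_
infix  4 _⊃_
infix  3 _≋_

data Fm : Set where
  ⊥ᶠ  : Fm
  atom : ℕ → Fm
  _⇒_ : Fm → Fm → Fm
  □_  : Fm → Fm

-- The multisets of a sequent are presented by lists; rules apply up to _≋_.
record Sequent : Set where
  constructor _⊃_
  field
    antecedent succedent : List Fm

data _≋_ : Sequent → Sequent → Set where
  _,_ : ∀ {Γ Γ′ Δ Δ′} → Γ ↭ Γ′ → Δ ↭ Δ′ → Γ ⊃ Δ ≋ Γ′ ⊃ Δ′

data System : Set where
  G3s G3s+Cut G3s+□Cut : System

-- Rule S ps c: the premises ps and conclusion c of a rule instance of S.
data Rule : System → List Sequent → Sequent → Set where
  ax   : ∀ {S} Γ Δ p → Rule S [] (atom p ∷ Γ ⊃ atom p ∷ Δ)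
  ⊥⊃   : ∀ {S} Γ Δ → Rule S [] (⊥ᶠ ∷ Γ ⊃ Δ)
  →⊃   : ∀ {S} Γ Δ A B →
         Rule S ((Γ ⊃ A ∷ Δ) ∷ (B ∷ Γ ⊃ Δ) ∷ []) (A ⇒ B ∷ Γ ⊃ Δ)
  ⊃→   : ∀ {S} Γ Δ A B →
         Rule S ((A ∷ Γ ⊃ B ∷ Δ) ∷ []) (Γ ⊃ A ⇒ B ∷ Δ)
  □⊃   : ∀ {S} Γ Δ A →
         Rule S ((A ∷ □ A ∷ Γ ⊃ Δ) ∷ []) (□ A ∷ Γ ⊃ Δ)
  ⊃□   : ∀ {S} Γ Γ′ Δ′ A →
         Rule S ((map □_ Γ ⊃ A ∷ []) ∷ []) (Γ′ ++ map □_ Γ ⊃ □ A ∷ Δ′)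
  cut  : ∀ Γ Δ A →
         Rule G3s+Cut ((Γ ⊃ A ∷ Δ) ∷ (A ∷ Γ ⊃ Δ) ∷ []) (Γ ⊃ Δ)
  □cut : ∀ Γ Δ A B →
         Rule G3s+□Cut ((Γ ⊃ □ A ∷ □ B ∷ Δ) ∷ (Γ ⊃ □ (A ⇒ B) ∷ □ B ∷ Δ) ∷ [])
                       (Γ ⊃ □ B ∷ Δ)

-- The permutation in infer is proof-relevant: it records which formula
-- occurrence of the listed conclusion is which formula of the rule scheme.
data Proof (S : System) : Sequent → Set where
  infer : ∀ {ps c s} → c ≋ s → Rule S ps c → All (Proof S) ps → Proof S s

-- Occurrences of the symbol □ in a formula, a list of formulas (Any □Occ), and
-- a sequent. Correspondence only ever relates equal symbols, so its restriction
-- to □-occurrences can be generated without mentioning other symbols.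
data □Occ : Fm → Set where
  outer : ∀ {A} → □Occ (□ A)
  under : ∀ {A} → □Occ A → □Occ (□ A)
  left  : ∀ {A B} → □Occ A → □Occ (A ⇒ B)
  right : ∀ {A B} → □Occ B → □Occ (A ⇒ B)

data SeqOcc : Sequent → Set where
  ante : ∀ {Γ Δ} → Any □Occ Γ → SeqOcc (Γ ⊃ Δ)
  succ : ∀ {Γ Δ} → Any □Occ Δ → SeqOcc (Γ ⊃ Δ)

transport : ∀ {s t} → s ≋ t → SeqOcc s → SeqOcc t
transport (σ , τ) (ante x) = ante (Any-resp-↭ σ x)
transport (σ , τ) (succ y) = succ (Any-resp-↭ τ y)

data RuleOcc (ps : List Sequent) (c : Sequent) : Set where
  concl   : SeqOcc c → RuleOcc ps c
  premise : ∀ {p} → p ∈ ps → SeqOcc p → RuleOcc ps c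

pattern prem₁ o = premise (here refl) o
pattern prem₂ o = premise (there (here refl)) o

-- Direct correspondence within a rule instance. Weakening formulas, and the
-- principal formulas of ax and ⊥⊃, correspond to nothing in the premises.
data Direct : ∀ {S ps c} → Rule S ps c → RuleOcc ps c → RuleOcc ps c → Set where

  →⊃-side-ante₁ : ∀ {S Γ Δ A B} (x : Any □Occ Γ) →
    Direct (→⊃ {S} Γ Δ A B) (prem₁ (ante x)) (concl (ante (there x)))
  →⊃-side-succ₁ : ∀ {S Γ Δ A B} (y : Any □Occ Δ) →
    Direct (→⊃ {S} Γ Δ A B) (prem₁ (succ (there y))) (concl (succ y))
  →⊃-active₁ : ∀ {S Γ Δ A B} (o : □Occ A) →
    Direct (→⊃ {S} Γ Δ A B) (prem₁ (succ (here o))) (concl (ante (here (left o))))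
  →⊃-side-ante₂ : ∀ {S Γ Δ A B} (x : Any □Occ Γ) →
    Direct (→⊃ {S} Γ Δ A B) (prem₂ (ante (there x))) (concl (ante (there x)))
  →⊃-side-succ₂ : ∀ {S Γ Δ A B} (y : Any □Occ Δ) →
    Direct (→⊃ {S} Γ Δ A B) (prem₂ (succ y)) (concl (succ y))
  →⊃-active₂ : ∀ {S Γ Δ A B} (o : □Occ B) →
    Direct (→⊃ {S} Γ Δ A B) (prem₂ (ante (here o))) (concl (ante (here (right o))))

  ⊃→-side-ante : ∀ {S Γ Δ A B} (x : Any □Occ Γ) →
    Direct (⊃→ {S} Γ Δ A B) (prem₁ (ante (there x))) (concl (ante x))
  ⊃→-side-succ : ∀ {S Γ Δ A B} (y : Any □Occ Δ) →
    Direct (⊃→ {S} Γ Δ A B) (prem₁ (succ (there y))) (concl (succ (there y)))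
  ⊃→-active-ante : ∀ {S Γ Δ A B} (o : □Occ A) →
    Direct (⊃→ {S} Γ Δ A B) (prem₁ (ante (here o))) (concl (succ (here (left o))))
  ⊃→-active-succ : ∀ {S Γ Δ A B} (o : □Occ B) →
    Direct (⊃→ {S} Γ Δ A B) (prem₁ (succ (here o))) (concl (succ (here (right o))))

  □⊃-side-ante : ∀ {S Γ Δ A} (x : Any □Occ Γ) →
    Direct (□⊃ {S} Γ Δ A) (prem₁ (ante (there (there x)))) (concl (ante (there x)))
  □⊃-side-succ : ∀ {S Γ Δ A} (y : Any □Occ Δ) →
    Direct (□⊃ {S} Γ Δ A) (prem₁ (succ y)) (concl (succ y))
  □⊃-active : ∀ {S Γ Δ A} (o : □Occ A) →
    Direct (□⊃ {S} Γ Δ A) (prem₁ (ante (here o))) (concl (ante (here (under o))))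
  □⊃-active□ : ∀ {S Γ Δ A} (o : □Occ (□ A)) →
    Direct (□⊃ {S} Γ Δ A) (prem₁ (ante (there (here o)))) (concl (ante (here o)))

  ⊃□-side : ∀ {S Γ Γ′ Δ′ A} (x : Any □Occ (map □_ Γ)) →
    Direct (⊃□ {S} Γ Γ′ Δ′ A) (prem₁ (ante x)) (concl (ante (++⁺ʳ Γ′ x)))
  ⊃□-active : ∀ {S Γ Γ′ Δ′ A} (o : □Occ A) →
    Direct (⊃□ {S} Γ Γ′ Δ′ A) (prem₁ (succ (here o))) (concl (succ (here (under o))))

  cut-side-ante₁ : ∀ {Γ Δ A} (x : Any □Occ Γ) →
    Direct (cut Γ Δ A) (prem₁ (ante x)) (concl (ante x))
  cut-side-succ₁ : ∀ {Γ Δ A} (y : Any □Occ Δ) →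
    Direct (cut Γ Δ A) (prem₁ (succ (there y))) (concl (succ y))
  cut-side-ante₂ : ∀ {Γ Δ A} (x : Any □Occ Γ) →
    Direct (cut Γ Δ A) (prem₂ (ante (there x))) (concl (ante x))
  cut-side-succ₂ : ∀ {Γ Δ A} (y : Any □Occ Δ) →
    Direct (cut Γ Δ A) (prem₂ (succ y)) (concl (succ y))
  cut-active : ∀ {Γ Δ A} (o : □Occ A) →
    Direct (cut Γ Δ A) (prem₁ (succ (here o))) (prem₂ (ante (here o)))

  □cut-side-ante₁ : ∀ {Γ Δ A B} (x : Any □Occ Γ) →
    Direct (□cut Γ Δ A B) (prem₁ (ante x)) (concl (ante x))
  □cut-side-succ₁ : ∀ {Γ Δ A B} (y : Any □Occ Δ) →
    Direct (□cut Γ Δ A B) (prem₁ (succ (there (there y)))) (concl (succ (there y)))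
  □cut-side-ante₂ : ∀ {Γ Δ A B} (x : Any □Occ Γ) →
    Direct (□cut Γ Δ A B) (prem₂ (ante x)) (concl (ante x))
  □cut-side-succ₂ : ∀ {Γ Δ A B} (y : Any □Occ Δ) →
    Direct (□cut Γ Δ A B) (prem₂ (succ (there (there y)))) (concl (succ (there y)))
  □cut-□B₁ : ∀ {Γ Δ A B} (o : □Occ (□ B)) →
    Direct (□cut Γ Δ A B) (prem₁ (succ (there (here o)))) (concl (succ (here o)))
  □cut-□B₂ : ∀ {Γ Δ A B} (o : □Occ (□ B)) →
    Direct (□cut Γ Δ A B) (prem₂ (succ (there (here o)))) (concl (succ (here o)))
  □cut-outer₁ : ∀ {Γ Δ A B} →
    Direct (□cut Γ Δ A B) (prem₁ (succ (here outer))) (concl (succ (here outer)))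
  □cut-outer₂ : ∀ {Γ Δ A B} →
    Direct (□cut Γ Δ A B) (prem₂ (succ (here outer))) (concl (succ (here outer)))
  □cut-A : ∀ {Γ Δ A B} (o : □Occ A) →
    Direct (□cut Γ Δ A B) (prem₁ (succ (here (under o))))
                          (prem₂ (succ (here (under (left o)))))
  □cut-B : ∀ {Γ Δ A B} (o : □Occ B) →
    Direct (□cut Γ Δ A B) (prem₂ (succ (here (under (right o)))))
                          (concl (succ (here (under o))))

data Occ {S : System} : ∀ {s} → Proof S s → Set where
  root  : ∀ {s} {d : Proof S s} → SeqOcc s → Occ d
  above : ∀ {ps c s} {σ : c ≋ s} {r : Rule S ps c} {ds : All (Proof S) ps} {p} →
          (i : p ∈ ps) → Occ (All.lookup ds i) → Occ (infer σ r ds)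

locate : ∀ {S ps c s} (σ : c ≋ s) (r : Rule S ps c) (ds : All (Proof S) ps) →
         RuleOcc ps c → Occ (infer σ r ds)
locate σ r ds (concl o)     = root (transport σ o)
locate σ r ds (premise i o) = above i (root o)

data DirectlyCorresponds {S : System} :
       ∀ {s} {d : Proof S s} → Occ d → Occ d → Set where
  last-rule : ∀ {ps c s} {σ : c ≋ s} {r : Rule S ps c} {ds : All (Proof S) ps}
              {u v} → Direct r u v →
              DirectlyCorresponds (locate σ r ds u) (locate σ r ds v)
  above     : ∀ {ps c s} {σ : c ≋ s} {r : Rule S ps c} {ds : All (Proof S) ps}
              {p} {i : p ∈ ps} {o o′ : Occ (All.lookup ds i)} →
              DirectlyCorresponds o o′ →
              DirectlyCorresponds {d = infer σ r ds} (above i o) (above i o′)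

-- The families of d are the equivalence classes of this relation.
Corresponds : ∀ {S s} (d : Proof S s) → Occ d → Occ d → Set
Corresponds d = EqClosure (DirectlyCorresponds {d = d})

-- BoxIntro o o′: some (⊃□) inference has the □-occurrence o in its premise and
-- o′ as the outermost □ of its principal formula.
data BoxIntro {S : System} : ∀ {s} {d : Proof S s} → Occ d → Occ d → Set where
  last-rule : ∀ {Γ Γ′ Δ′ A s} {σ : (Γ′ ++ map □_ Γ ⊃ □ A ∷ Δ′) ≋ s}
              {ds : All (Proof S) ((map □_ Γ ⊃ A ∷ []) ∷ [])}
              (o : SeqOcc (map □_ Γ ⊃ A ∷ [])) →
              BoxIntro (locate σ (⊃□ Γ Γ′ Δ′ A) ds (prem₁ o))
                       (locate σ (⊃□ Γ Γ′ Δ′ A) ds (concl (succ (here outer))))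
  above     : ∀ {ps c s} {σ : c ≋ s} {r : Rule S ps c} {ds : All (Proof S) ps}
              {p} {i : p ∈ ps} {o o′ : Occ (All.lookup ds i)} →
              BoxIntro o o′ →
              BoxIntro {d = infer σ r ds} (above i o) (above i o′)

-- The prehistoric relation between the families of i and j. Families are given
-- by representatives; the relation is invariant under Corresponds d.
Prehistoric : ∀ {S s} (d : Proof S s) → Occ d → Occ d → Set
Prehistoric d i j =
  ∃[ o ] ∃[ o′ ] Corresponds d i o × BoxIntro o o′ × Corresponds d o′ j

PrehistoricCycle : ∀ {S s} → Proof S s → Set
PrehistoricCycle d = ∃[ i ] TransClosure (Prehistoric d) i i

CycleFree : ∀ {S s} → Proof S s → Set
CycleFree d = ¬ PrehistoricCycle d

CycleFreeFragment : System → Pred Sequent 0ℓ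
CycleFreeFragment S s = Σ[ d ∈ Proof S s ] CycleFree d

module Submission where

-- A proof is prehistoric-cycle-free exactly when its families can be ranked by
-- natural numbers so that every □ in the premise of (⊃□) has smaller rank than
-- the □ it introduces. Carrying these ranks on the formulas gives a ranked
-- sequent calculus, and both cuts are admissible in it. When a formula □A of
-- rank n is cut and the right premise ends with a (⊃□) introducing rank m whose
-- premise contains □A, then n < m, and so the boxes that replace □A there,
-- which are below n, are also below m. In (□Cut) all outer boxes have the same
-- rank n; the (⊃□) premises □Γ ⊃ A and □Γ′ ⊃ A → B, all below n, give
-- □Γ, □Γ′ ⊃ B by a cut on A, and (⊃□) again introduces □B of rank n.

open import Defs
open import Data.Empty using (⊥)
open import Data.List.Base using (List; []; _∷_; _++_; map)
open import Data.List.Membership.Propositional using (_∈_)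
open import Data.List.Membership.Propositional.Properties
  using (∈-++⁻; ∈-++⁺ˡ; ∈-++⁺ʳ; ∈-map⁺; ∈-map⁻)
open import Data.List.Relation.Binary.Permutation.Propositional
  using (_↭_; refl; prep; swap; trans)
open import Data.List.Relation.Binary.Permutation.Propositional.Properties
  using (Any-resp-↭)
open import Data.List.Relation.Binary.Subset.Propositional using (_⊆_)
open import Data.List.Relation.Binary.Subset.Propositional.Properties
  using (∷⁺ʳ; ⊆∷⇒∈∨⊆; ∈-∷⁺ʳ; xs⊆xs++ys; xs⊆ys++xs)
open import Data.List.Relation.Unary.All as All using (All; []; _∷_)
open import Data.List.Relation.Unary.All.Properties using (++⁺; anti-mono)
open import Data.List.Relation.Unary.Any using (Any; here; there)
open import Data.List.Relation.Unary.Any.Properties using (++⁺ʳ)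
open import Data.Nat.Base using (ℕ; suc; _+_; _<_; _≤_; z≤n; s≤s)
open import Data.Nat.Properties
  using (_<?_; <-trans; <-irrefl; <-≤-trans; ≤-trans; ≤-antisym; m≤m+n; m≤n+m;
         +-monoʳ-≤; +-monoʳ-<)
open import Data.Product.Base as Product
  using (Σ-syntax; ∃-syntax; _×_; _,_; proj₁; proj₂; uncurry)
open import Data.Sum.Base using (_⊎_; inj₁; inj₂; [_,_]′)
open import Data.Unit.Base using (⊤; tt)
open import Function.Base using (_∘_; id)
open import Relation.Binary.Construct.Closure.ReflexiveTransitive as Star
  using (Star; ε; _◅_; _◅◅_)
open import Relation.Binary.Construct.Closure.Symmetric using (SymClosure; fwd; bwd)
open import Relation.Binary.Construct.Closure.Transitive as Plus
  using (TransClosure; [_]; _∷_)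
open import Relation.Binary.Definitions using (Decidable; DecidableEquality)
open import Relation.Binary.PropositionalEquality as ≡
  using (_≡_; refl; sym; cong; cong₂; subst; subst₂)
open import Relation.Nullary.Decidable.Core
  using (Dec; yes; no; map′; _⊎-dec_; _×-dec_)
open import Relation.Nullary.Negation.Core using (¬_; contradiction)
open import Relation.Unary using (_≐_)

-- Ranked sequents

infix  9 □[_]_
infixr 8 _⊸_
infix  4 _⊢_

-- Formulas in which every □ carries the rank of its family.
data RFm : Set where
  ⊥ᶠ    : RFm
  atom  : ℕ → RFm
  _⊸_   : RFm → RFm → RFm
  □[_]_ : ℕ → RFm → RFm

Below : ℕ → RFm → Set
Below n ⊥ᶠ         = ⊤
Below n (atom p)   = ⊤
Below n (A ⊸ B)    = Below n A × Below n B
Below n (□[ m ] A) = m < n × Below n A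

data Boxed : RFm → Set where
  box : ∀ {n A} → Boxed (□[ n ] A)

Below□ : ℕ → RFm → Set
Below□ n A = Boxed A × Below n A

below? : ∀ n A → Dec (Below n A)
below? n ⊥ᶠ         = yes tt
below? n (atom p)   = yes tt
below? n (A ⊸ B)    = below? n A ×-dec below? n B
below? n (□[ m ] A) = (m <? n) ×-dec below? n A

boxed? : ∀ A → Dec (Boxed A)
boxed? ⊥ᶠ         = no λ ()
boxed? (atom p)   = no λ ()
boxed? (A ⊸ B)    = no λ ()
boxed? (□[ n ] A) = yes box

below□? : ∀ n A → Dec (Below□ n A)
below□? n A = boxed? A ×-dec below? n A

Below-mono : ∀ {m n} A → m < n → Below m A → Below n A
Below-mono ⊥ᶠ         m<n _         = tt
Below-mono (atom p)   m<n _         = tt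
Below-mono (A ⊸ B)    m<n (a , b)   = Below-mono A m<n a , Below-mono B m<n b
Below-mono (□[ k ] A) m<n (k<m , a) = <-trans k<m m<n , Below-mono A m<n a

private variable
  n p : ℕ
  A B C X : RFm
  Γ Γ₁ Γ₂ Δ Δ₁ Δ₂ Θ : List RFm
  F : Fm
  Fs Gs Hs : List Fm
  S : System
  I J : Set

-- Contexts are read as sets: principal formulas stay in the premises.
data _⊢_ : List RFm → List RFm → Set where
  ax : atom p ∈ Γ → atom p ∈ Δ → Γ ⊢ Δ
  ⊥⊃ : ⊥ᶠ ∈ Γ → Γ ⊢ Δ
  →⊃ : A ⊸ B ∈ Γ → Γ ⊢ A ∷ Δ → B ∷ Γ ⊢ Δ → Γ ⊢ Δ
  ⊃→ : A ⊸ B ∈ Δ → A ∷ Γ ⊢ B ∷ Δ → Γ ⊢ Δ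
  □⊃ : □[ n ] A ∈ Γ → A ∷ Γ ⊢ Δ → Γ ⊢ Δ
  ⊃□ : □[ n ] A ∈ Δ → Θ ⊆ Γ → All (Below□ n) Θ → Below n A →
       Θ ⊢ A ∷ [] → Γ ⊢ Δ

-- Left Γ Δ A (Right Γ Δ A): inverting the implication rules on an A in the
-- antecedent (succedent) can lead to the sequent Γ ⊃ Δ. This makes weakening,
-- contraction and inversion the single lemma reduce, proved by structural
-- induction without heights.
mutual
  data Left (Γ Δ : List RFm) : RFm → Set where
    side : A ∈ Γ → Left Γ Δ A
    ⊸₁   : Right Γ Δ A → Left Γ Δ (A ⊸ B)
    ⊸₂   : Left Γ Δ B → Left Γ Δ (A ⊸ B)

  data Right (Γ Δ : List RFm) : RFm → Set where
    side : A ∈ Δ → Right Γ Δ A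
    _⊸_  : Left Γ Δ A → Right Γ Δ B → Right Γ Δ (A ⊸ B)

AllLeft AllRight : List RFm → List RFm → List RFm → Set
AllLeft  Γ Δ Ξ = ∀ {A} → A ∈ Ξ → Left Γ Δ A
AllRight Γ Δ Ξ = ∀ {A} → A ∈ Ξ → Right Γ Δ A

infixr 5 _∷ˡ_ _∷ʳ_
_∷ˡ_ : Left Γ Δ A → AllLeft Γ Δ Γ₁ → AllLeft Γ Δ (A ∷ Γ₁)
(a ∷ˡ as) (here refl) = a
(a ∷ˡ as) (there i)   = as i

_∷ʳ_ : Right Γ Δ A → AllRight Γ Δ Δ₁ → AllRight Γ Δ (A ∷ Δ₁)
(a ∷ʳ as) (here refl) = a
(a ∷ʳ as) (there i)   = as i

mutual
  -- Inversions compose: at each leaf `side`, the inversion of that leaf itself is grafted on.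
  Left-bind : AllLeft Γ₂ Δ₂ Γ₁ → AllRight Γ₂ Δ₂ Δ₁ → Left Γ₁ Δ₁ A → Left Γ₂ Δ₂ A
  Left-bind l r (side i) = l i
  Left-bind l r (⊸₁ a)   = ⊸₁ (Right-bind l r a)
  Left-bind l r (⊸₂ b)   = ⊸₂ (Left-bind l r b)

  Right-bind : AllLeft Γ₂ Δ₂ Γ₁ → AllRight Γ₂ Δ₂ Δ₁ → Right Γ₁ Δ₁ A → Right Γ₂ Δ₂ A
  Right-bind l r (side i) = r i
  Right-bind l r (a ⊸ b)  = Left-bind l r a ⊸ Right-bind l r b

⊆⇒AllLeft : Γ₁ ⊆ Γ → AllLeft Γ Δ Γ₁
⊆⇒AllLeft s i = side (s i)

⊆⇒AllRight : Δ₁ ⊆ Δ → AllRight Γ Δ Δ₁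
⊆⇒AllRight s i = side (s i)

Left-mono : Γ₁ ⊆ Γ₂ → Δ₁ ⊆ Δ₂ → Left Γ₁ Δ₁ A → Left Γ₂ Δ₂ A
Left-mono s t = Left-bind (⊆⇒AllLeft s) (⊆⇒AllRight t)

Right-mono : Γ₁ ⊆ Γ₂ → Δ₁ ⊆ Δ₂ → Right Γ₁ Δ₁ A → Right Γ₂ Δ₂ A
Right-mono s t = Right-bind (⊆⇒AllLeft s) (⊆⇒AllRight t)

-- Inversion takes only implications apart, so a boxed formula can only be a side formula.
Left-boxed : Boxed A → Left Γ Δ A → A ∈ Γ
Left-boxed box (side i) = i

reduce : Γ₁ ⊢ Δ₁ → AllLeft Γ Δ Γ₁ → AllRight Γ Δ Δ₁ → Γ ⊢ Δ
reduce (ax i j) l r with l i | r j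
... | side i′ | side j′ = ax i′ j′
reduce (⊥⊃ i) l r with l i
... | side i′ = ⊥⊃ i′
reduce (→⊃ i D E) l r with l i
-- The implication has been inverted already: the rule vanishes and only the premise chosen by the
-- inversion is kept.
... | ⊸₁ a = reduce D l (a ∷ʳ r)
... | ⊸₂ b = reduce E (b ∷ˡ l) r
... | side i′ = →⊃ i′
  (reduce D (Left-mono id there ∘ l) (side (here refl) ∷ʳ Right-mono id there ∘ r))
  (reduce E (side (here refl) ∷ˡ Left-mono there id ∘ l) (Right-mono there id ∘ r))
reduce (⊃→ j D) l r with r j
... | a ⊸ b = reduce D (a ∷ˡ l) (b ∷ʳ r)
... | side j′ = ⊃→ j′
  (reduce D (side (here refl) ∷ˡ Left-mono there there ∘ l)
            (side (here refl) ∷ʳ Right-mono there there ∘ r))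
reduce (□⊃ i D) l r with l i
... | side i′ = □⊃ i′ (reduce D (side (here refl) ∷ˡ Left-mono there id ∘ l)
                                (Right-mono there id ∘ r))
reduce (⊃□ j s lo b D) l r with r j
-- The premise `D` stays as it is, because its antecedent consists of boxed formulas, which
-- inversion leaves whole.
... | side j′ = ⊃□ j′ (λ i → Left-boxed (proj₁ (All.lookup lo i)) (l (s i))) lo b D

weaken : Γ₁ ⊆ Γ₂ → Δ₁ ⊆ Δ₂ → Γ₁ ⊢ Δ₁ → Γ₂ ⊢ Δ₂
weaken s t D = reduce D (⊆⇒AllLeft s) (⊆⇒AllRight t)

-- Admissibility of the two cuts

-- What a right rule or axiom with principal formula `X` provides once any kept copy of `X` has been
-- removed from its premise. There is no case for `⊥ᶠ`, which no rule introduces in the succedent.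
data Introduced (Γ Δ : List RFm) : RFm → Set where
  atom : atom p ∈ Γ → Introduced Γ Δ (atom p)
  imp  : A ∷ Γ ⊢ B ∷ Δ → Introduced Γ Δ (A ⊸ B)
  box  : Θ ⊆ Γ → All (Below□ n) Θ → Below n A → Θ ⊢ A ∷ [] →
         Introduced Γ Δ (□[ n ] A)

keep : ∀ C → Δ₁ ⊆ X ∷ Δ → C ∷ Δ₁ ⊆ X ∷ C ∷ Δ
keep C t (here e) = there (here e)
keep C t (there i) with t i
... | here e  = here e
... | there k = there (there k)

-- The proof is climbed along the occurrences of `X` in the succedent, and the last argument closes
-- each sequent in which `X` is principal. It is quantified over larger contexts because the rules
-- passed on the way add formulas. Above (⊃□) nothing is traced, as its premise drops the rest of
-- the succedent.
replace-introduced : Γ₁ ⊢ Δ₁ → Γ₁ ⊆ Γ → Δ₁ ⊆ X ∷ Δ →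
  (∀ {Γ′ Δ′} → Γ ⊆ Γ′ → Δ ⊆ Δ′ → Introduced Γ′ Δ′ X → Γ′ ⊢ Δ′) → Γ ⊢ Δ
replace-introduced (ax i j) s t k with t j
... | here refl = k id id (atom (s i))
... | there j′  = ax (s i) j′
replace-introduced (⊥⊃ i) s t k = ⊥⊃ (s i)
replace-introduced (→⊃ {A = A} {B} i D E) s t k = →⊃ (s i)
  (replace-introduced D s (keep A t) λ u v → k u (v ∘ there))
  (replace-introduced E (∷⁺ʳ B s) t λ u v → k (u ∘ there) v)
replace-introduced (⊃→ {A} {B} j D) s t k
  -- The premise still contains `X` when `X` is principal; it is removed there first, as `imp` asks
  -- for the succedent B, Δ.
  with D′ ← replace-introduced D (∷⁺ʳ A s) (keep B t) (λ u v → k (u ∘ there) (v ∘ there))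
  with t j
... | here refl = k id id (imp D′)
... | there j′  = ⊃→ j′ D′
replace-introduced (□⊃ {A = A} i D) s t k = □⊃ (s i)
  (replace-introduced D (∷⁺ʳ A s) t λ u v → k (u ∘ there) v)
replace-introduced (⊃□ j u lo b D) s t k with t j
... | here refl = k id id (box (s ∘ u) lo b D)
... | there j′  = ⊃□ j′ (s ∘ u) lo b D

CutAdmissible : RFm → Set
CutAdmissible A = ∀ {Γ Δ} → Γ ⊢ A ∷ Δ → A ∷ Γ ⊢ Δ → Γ ⊢ Δ

++-⊆ : Γ₁ ⊆ Γ → Γ₂ ⊆ Γ → Γ₁ ++ Γ₂ ⊆ Γ
++-⊆ s t i = [ s , t ]′ (∈-++⁻ _ i)

-- The inclusion itself tells, member by member, whether an element of `Θ` is dropped as `X` or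
-- belongs to `Γ`.
without : Θ ⊆ X ∷ Γ → ∃[ Θ′ ] Θ′ ⊆ Γ × Θ′ ⊆ Θ × Θ ⊆ X ∷ Θ′
without {[]}    s = [] , (λ ()) , (λ ()) , λ ()
without {Y ∷ Θ} s with without (s ∘ there) | s (here refl)
... | Θ′ , a , b , c | here refl = Θ′ , a , there ∘ b , ∈-∷⁺ʳ (here refl) c
... | Θ′ , a , b , c | there i   =
  Y ∷ Θ′ , ∈-∷⁺ʳ i a , ∷⁺ʳ Y b , keep Y c

-- The left premise of the cut is represented by the premise `Θ ⊢ A ∷ []` of its (⊃□), which is
-- fixed while the induction climbs the right premise. Each (□⊃) on the cut formula becomes a cut on
-- `A`.
cut-box : CutAdmissible A → All (Below□ n) Θ → Θ ⊢ A ∷ [] →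
          Γ₁ ⊢ Δ₁ → Γ₁ ⊆ □[ n ] A ∷ Γ → Δ₁ ⊆ Δ → Θ ⊆ Γ → Γ ⊢ Δ
cut-box cutA lo D (ax i j) s t u with s i
... | there i′ = ax i′ (t j)
cut-box cutA lo D (⊥⊃ i) s t u with s i
... | there i′ = ⊥⊃ i′
cut-box cutA lo D (→⊃ {A = B} {C} i E F) s t u with s i
... | there i′ = →⊃ i′ (cut-box cutA lo D E s (∷⁺ʳ B t) u)
                       (cut-box cutA lo D F (keep C s) t (there ∘ u))
cut-box cutA lo D (⊃→ {B} {C} j E) s t u =
  ⊃→ (t j) (cut-box cutA lo D E (keep B s) (∷⁺ʳ C t) (there ∘ u))
cut-box cutA lo D (□⊃ {A = B} i E) s t u
  with E′ ← cut-box cutA lo D E (keep B s) t (there ∘ u)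
  with s i
... | here refl = cutA (weaken u (λ { (here e) → here e }) D) E′
... | there i′  = □⊃ i′ E′
cut-box {A = A} {n} {Θ} cutA lo D (⊃□ {Θ = Ξ} j v lo′ b′ E) s t u
  with ⊆∷⇒∈∨⊆ (s ∘ v)
-- The premise is covered by `Γ` without the cut formula, so the rule applies unchanged.
... | inj₂ w = ⊃□ (t j) w lo′ b′ E
-- `Ξ′` is the premise context less the cut formula, and `Θ` takes its place. The cut formula
-- occurring in the premise yields `n<m`, which bounds `Θ`.
... | inj₁ m with Ξ′ , p , q , r ← without (s ∘ v) =
  ⊃□ (t j) (++-⊆ u p) (++⁺ (All.map weaker lo) (anti-mono q lo′)) b′
     (cut-box cutA lo D E (widen r) id (xs⊆xs++ys Θ Ξ′))
  where
  n<m = proj₁ (proj₂ (All.lookup lo′ m))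
  weaker : ∀ {B} → Below□ n B → Below□ _ B
  weaker {B} (x , y) = x , Below-mono B n<m y
  widen : ∀ {Φ Ψ} → Φ ⊆ X ∷ Ψ → Φ ⊆ X ∷ Θ ++ Ψ
  widen r i with r i
  ... | here e  = here e
  ... | there k = there (xs⊆ys++xs _ Θ k)

-- Recursion is on `A` alone: the inductions over the premises take place in `replace-introduced`
-- and `cut-box`, to which the smaller cuts are handed as arguments.
cut-admissible : ∀ A → CutAdmissible A
cut-admissible A D E = replace-introduced D id id (step A E)
  where
  step : ∀ A → A ∷ Γ ⊢ Δ → ∀ {Γ′ Δ′} → Γ ⊆ Γ′ → Δ ⊆ Δ′ →
         Introduced Γ′ Δ′ A → Γ′ ⊢ Δ′
  step (atom p) E s t (atom i) = weaken (∈-∷⁺ʳ i s) t E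
  -- `E` is inverted twice: to Γ′ ⊃ A, B, Δ′, cut with `D` on `A`, and to B, Γ′ ⊃ Δ′, for the cut on
  -- `B`.
  step (A ⊸ B) E s t (imp D) = cut-admissible B
    (cut-admissible A
      (reduce E (⊸₁ (side (here refl)) ∷ˡ λ i → side (s i))
                (λ i → side (there (there (t i)))))
      D)
    (reduce E (⊸₂ (side (here refl)) ∷ˡ λ i → side (there (s i)))
              (λ i → side (t i)))
  step (□[ n ] A) E s t (box u lo _ D) =
    cut-box (cut-admissible A) lo D E (∷⁺ʳ _ s) t u

-- The traversals of the two premises are nested, so that a (⊃□) introducing □A meets one
-- introducing □(A → B). Both have rank `n`, hence both contexts may stand in the premise of a (⊃□)
-- for □B.
□cut-admissible : ∀ A B → □[ n ] B ∈ Δ →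
  Γ ⊢ □[ n ] A ∷ Δ → Γ ⊢ □[ n ] (A ⊸ B) ∷ Δ → Γ ⊢ Δ
□cut-admissible A B j D E =
  replace-introduced D id id λ { s t (box {Θ} u lo a D′) →
  replace-introduced E s (∷⁺ʳ _ t) λ { s′ t′ (box {Ξ} v lo′ (_ , b) E′) →
  ⊃□ (t′ (t j)) (++-⊆ (s′ ∘ u) v) (++⁺ lo lo′) b
    (cut-admissible A (weaken (xs⊆xs++ys Θ Ξ) (λ { (here e) → here e }) D′)
      -- Inverting the implication in `E′` gives A, Θ, Ξ ⊃ B, to be cut against `D′`.
      (reduce E′ (λ i → side (there (xs⊆ys++xs Ξ Θ i)))
        ((side (here refl) ⊸ side (here refl)) ∷ʳ λ ()))) } }

-- Ranked proofs

rank : (F : Fm) → (□Occ F → ℕ) → RFm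
rank ⊥ᶠ       f = ⊥ᶠ
rank (atom p) f = atom p
rank (F ⇒ G)  f = rank F (f ∘ left) ⊸ rank G (f ∘ right)
rank (□ F)    f = □[ f outer ] rank F (f ∘ under)

ranks : (Fs : List Fm) → (Any □Occ Fs → ℕ) → List RFm
ranks []       f = []
ranks (F ∷ Fs) f = rank F (f ∘ here) ∷ ranks Fs (f ∘ there)

Below-rank : ∀ F {f} → (∀ o → f o < n) → Below n (rank F f)
Below-rank ⊥ᶠ       f< = tt
Below-rank (atom p) f< = tt
Below-rank (F ⇒ G)  f< = Below-rank F (f< ∘ left) , Below-rank G (f< ∘ right)
Below-rank (□ F)    f< = f< outer , Below-rank F (f< ∘ under)

Below-rank⁻ : ∀ F {f} → Below n (rank F f) → ∀ o → f o < n
Below-rank⁻ (F ⇒ G) (a , b) (left o)  = Below-rank⁻ F a o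
Below-rank⁻ (F ⇒ G) (a , b) (right o) = Below-rank⁻ G b o
Below-rank⁻ (□ F)   (a , b) outer     = a
Below-rank⁻ (□ F)   (a , b) (under o) = Below-rank⁻ F b o

ranks-↭ : (σ : Fs ↭ Gs) (f : Any □Occ Gs → ℕ) →
          ranks Fs (f ∘ Any-resp-↭ σ) ⊆ ranks Gs f
ranks-↭ refl         f i                   = i
ranks-↭ (prep F σ)   f (here e)            = here e
ranks-↭ (prep F σ)   f (there i)           = there (ranks-↭ σ (f ∘ there) i)
ranks-↭ (swap F G σ) f (here e)            = there (here e)
ranks-↭ (swap F G σ) f (there (here e))    = here e
ranks-↭ (swap F G σ) f (there (there i))   = there (there (ranks-↭ σ (f ∘ there ∘ there) i))
ranks-↭ (trans σ τ)  f i                   = ranks-↭ τ f (ranks-↭ σ (f ∘ Any-resp-↭ τ) i)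

ranks-++ʳ : ∀ Fs {Gs} (f : Any □Occ (Fs ++ Gs) → ℕ) →
            ranks Gs (f ∘ ++⁺ʳ Fs) ⊆ ranks (Fs ++ Gs) f
ranks-++ʳ []       f i = i
ranks-++ʳ (F ∷ Fs) f i = there (ranks-++ʳ Fs (f ∘ there) i)

Below□-ranks : ∀ Fs {f} → (∀ o → f o < n) → All (Below□ n) (ranks (map □_ Fs) f)
Below□-ranks []       f< = []
Below□-ranks (F ∷ Fs) f< = (box , Below-rank (□ F) (f< ∘ here)) ∷ Below□-ranks Fs (f< ∘ there)

-- Ranked rules find a principal formula by membership, whereas the rules of `Proof` want it at the
-- head of a list; `σ` brings it there together with its labels.
record Pull (Fs : List Fm) (f : Any □Occ Fs → ℕ) (X : RFm) : Set where
  constructor pull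
  field
    {head}  : Fm
    {tail}  : List Fm
    σ       : head ∷ tail ↭ Fs
    head-≡  : rank head (f ∘ Any-resp-↭ σ ∘ here) ≡ X
    ranks-⊆ : ranks Fs f ⊆ ranks (head ∷ tail) (f ∘ Any-resp-↭ σ)

pull-∈ : ∀ Fs f → X ∈ ranks Fs f → Pull Fs f X
pull-∈ (F ∷ Fs) f (here e)  = pull refl (sym e) id
pull-∈ (F ∷ Fs) f (there i) with pull {G} σ e s ← pull-∈ Fs (f ∘ there) i =
  pull (trans (swap G F refl) (prep F σ)) e (keep _ s)

-- In contrast to the library's shift, this permutation acts on occurrences by
-- a simple recursion.
insert : ∀ (F : Fm) Fs Gs → Fs ++ F ∷ Gs ↭ F ∷ Fs ++ Gs
insert F []       Gs = refl
insert F (G ∷ Fs) Gs = trans (prep G (insert F Fs Gs)) (swap G F refl)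

insert-here : ∀ F Fs Gs (o : □Occ F) →
  Any-resp-↭ (insert F Fs Gs) (++⁺ʳ Fs (here {P = □Occ} o)) ≡ here o
insert-here F []       Gs o = refl
insert-here F (G ∷ Fs) Gs o =
  cong (Any-resp-↭ (swap G F refl) ∘ there) (insert-here F Fs Gs o)

insert-there : ∀ F Fs Gs (x : Any □Occ Gs) →
  Any-resp-↭ (insert F Fs Gs) (++⁺ʳ Fs (there x)) ≡ there (++⁺ʳ Fs x)
insert-there F []       Gs x = refl
insert-there F (G ∷ Fs) Gs x =
  cong (Any-resp-↭ (swap G F refl) ∘ there) (insert-there F Fs Gs x)

rank-cong : ∀ F {f g} → (∀ o → f o ≡ g o) → rank F f ≡ rank F g
rank-cong ⊥ᶠ       e = refl
rank-cong (atom p) e = refl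
rank-cong (F ⇒ G)  e = cong₂ _⊸_ (rank-cong F (e ∘ left)) (rank-cong G (e ∘ right))
rank-cong (□ F)    e = cong₂ □[_]_ (e outer) (rank-cong F (e ∘ under))

ranks-cong : ∀ Fs {f g} → (∀ o → f o ≡ g o) → ranks Fs f ≡ ranks Fs g
ranks-cong []       e = refl
ranks-cong (F ∷ Fs) e = cong₂ _∷_ (rank-cong F (e ∘ here)) (ranks-cong Fs (e ∘ there))

-- The antecedent split into the form that a conclusion of (⊃□) has. `boxed` is the largest
-- admissible choice, so by `complete` it covers whichever `Θ` a ranked (⊃□) selected.
record Boxes (n : ℕ) (Fs : List Fm) (f : Any □Occ Fs → ℕ) : Set where
  constructor boxes
  field
    {rest boxed} : List Fm
    σ            : rest ++ map □_ boxed ↭ Fs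
    bounded      : ∀ x → f (Any-resp-↭ σ (++⁺ʳ rest x)) < n
    complete     : ∀ {X} → X ∈ ranks Fs f → Below□ n X →
                   X ∈ ranks (map □_ boxed) (f ∘ Any-resp-↭ σ ∘ ++⁺ʳ rest)

select-boxes : ∀ n Fs f → Boxes n Fs f
select-boxes n [] f = boxes {rest = []} {[]} refl (λ ()) λ ()
select-boxes n (F ∷ Fs) f
  with boxes {Gs} {Hs} σ bd c ← select-boxes n Fs (f ∘ there)
  with below□? n (rank F (f ∘ here))
... | no ¬b = boxes {rest = F ∷ Gs} {Hs} (prep F σ) bd
  λ { (here refl) b → contradiction b ¬b ; (there i) b → c i b }
select-boxes n (□ F ∷ Fs) f | yes (_ , b) =
  boxes {rest = Gs} {F ∷ Hs} (trans (insert (□ F) Gs (map □_ Hs)) (prep (□ F) σ))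
  (λ { (here o)  → subst (_< n) (sym (g-here o)) (Below-rank⁻ (□ F) {f ∘ here} b o)
     ; (there x) → subst (_< n) (sym (g-there x)) (bd x) })
  λ { (here refl) _ → here (rank-cong (□ F) {f ∘ here} (sym ∘ g-here))
    ; (there i)   b → there (subst (_ ∈_) (ranks-cong (map □_ Hs) (sym ∘ g-there)) (c i b)) }
  where
  g : Any □Occ (□ F ∷ Gs ++ map □_ Hs) → ℕ
  g = f ∘ Any-resp-↭ (prep (□ F) σ)
  g-here : ∀ o → g (Any-resp-↭ (insert (□ F) Gs (map □_ Hs)) (++⁺ʳ Gs (here o))) ≡ f (here o)
  g-here o = cong g (insert-here (□ F) Gs (map □_ Hs) o)
  g-there : ∀ x → g (Any-resp-↭ (insert (□ F) Gs (map □_ Hs)) (++⁺ʳ Gs (there x)))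
                ≡ f (there (Any-resp-↭ σ (++⁺ʳ Gs x)))
  g-there x = cong g (insert-there (□ F) Gs (map □_ Hs) x)

-- Labellings of proofs

-- A labelling constant on families and strictly increasing along the prehistoric relation. The
-- labels `h` of the end sequent are a parameter, since they are what passes from a proof in one
-- system to a proof in another.
record Labelled {s} (d : Proof S s) (h : SeqOcc s → ℕ) : Set where
  field
    label  : Occ d → ℕ
    root-≡ : ∀ o → label (root o) ≡ h o
    resp   : ∀ {o o′} → DirectlyCorresponds o o′ → label o ≡ label o′
    mono   : ∀ {o o′} → BoxIntro o o′ → label o < label o′
open Labelled

module _ {s} {d : Proof S s} {h} (L : Labelled d h) where

  Corresponds⇒≡ : ∀ {i j} → Corresponds d i j → label L i ≡ label L j
  Corresponds⇒≡ ε            = refl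
  Corresponds⇒≡ (fwd c ◅ cs) = ≡.trans (resp L c) (Corresponds⇒≡ cs)
  Corresponds⇒≡ (bwd c ◅ cs) = ≡.trans (sym (resp L c)) (Corresponds⇒≡ cs)

  Prehistoric⇒< : ∀ {i j} → Prehistoric d i j → label L i < label L j
  Prehistoric⇒< (_ , _ , c , b , c′)
    rewrite Corresponds⇒≡ c | sym (Corresponds⇒≡ c′) = mono L b

  Prehistoric⁺⇒< : ∀ {i j} → TransClosure (Prehistoric d) i j → label L i < label L j
  Prehistoric⁺⇒< [ p ]    = Prehistoric⇒< p
  Prehistoric⁺⇒< (p ∷ ps) = <-trans (Prehistoric⇒< p) (Prehistoric⁺⇒< ps)

  Labelled⇒CycleFree : CycleFree d
  Labelled⇒CycleFree (_ , c) = <-irrefl refl (Prehistoric⁺⇒< c)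

value : ∀ {ps c s} → c ≋ s → (SeqOcc s → ℕ) → (∀ {p} → p ∈ ps → SeqOcc p → ℕ) →
        RuleOcc ps c → ℕ
value σ h g (concl o)     = h (transport σ o)
value σ h g (premise i o) = g i o

Increasing : ∀ {ps c} → Rule S ps c → (RuleOcc ps c → ℕ) → Set
Increasing (⊃□ Γ Γ′ Δ′ A) v = ∀ o → v (prem₁ o) < v (concl (succ (here outer)))
Increasing _ v = ⊤

-- Each direct correspondence and each `BoxIntro` pair stems from the last rule or from within one
-- premise, so only the last rule leaves conditions to check.
infer-Labelled : ∀ {ps c s} {σ : c ≋ s} {r : Rule S ps c} {ds : All (Proof S) ps} {h}
  (g : ∀ {p} → p ∈ ps → SeqOcc p → ℕ) →
  (∀ {p} (i : p ∈ ps) → Labelled (All.lookup ds i) (g i)) →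
  (∀ {u v} → Direct r u v → value σ h g u ≡ value σ h g v) →
  Increasing r (value σ h g) →
  Labelled (infer σ r ds) h
infer-Labelled {S = S} {ps} {c} {s} {σ} {r} {ds} {h} g Ls dir inc = record
  { label = lab ; root-≡ = λ _ → refl ; resp = rsp ; mono = mno inc }
  where
  lab : ∀ {r : Rule S ps c} → Occ (infer σ r ds) → ℕ
  lab (root o)    = h o
  lab (above i o) = label (Ls i) o
  lab-locate : ∀ {r : Rule S ps c} u → lab (locate σ r ds u) ≡ value σ h g u
  lab-locate (concl o)     = refl
  lab-locate (premise i o) = root-≡ (Ls i) o
  rsp : ∀ {o o′ : Occ (infer σ r ds)} → DirectlyCorresponds o o′ → lab o ≡ lab o′
  rsp (last-rule {u = u} {v} D) = ≡.trans (lab-locate u) (≡.trans (dir D) (sym (lab-locate v)))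
  rsp (above {i = i} D)         = resp (Ls i) D
  mno : ∀ {r : Rule S ps c} → Increasing r (value σ h g) →
        ∀ {o o′ : Occ (infer σ r ds)} → BoxIntro o o′ → lab o < lab o′
  mno inc (last-rule o)     = subst (_< _) (sym (root-≡ (Ls (here refl)) o)) (inc o)
  mno inc (above {i = i} b) = mono (Ls i) b

_∣_ : (Any □Occ Fs → ℕ) → (Any □Occ Gs → ℕ) → SeqOcc (Fs ⊃ Gs) → ℕ
(f ∣ g) (ante x) = f x
(f ∣ g) (succ y) = g y

infixr 5 _◂_
_◂_ : (□Occ F → ℕ) → (Any □Occ Fs → ℕ) → Any □Occ (F ∷ Fs) → ℕ
(f ◂ fs) (here o)  = f o
(f ◂ fs) (there x) = fs x

Realised : System → (Fs Gs : List Fm) → (Any □Occ Fs → ℕ) → (Any □Occ Gs → ℕ) → Set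
Realised S Fs Gs f g = Σ[ d ∈ Proof S (Fs ⊃ Gs) ] Labelled d (f ∣ g)


module _ {ps : List Sequent} where

  infixr 5 _∷ᵖ_
  _∷ᵖ_ : ∀ {q} → (SeqOcc q → ℕ) → (∀ {p} → p ∈ ps → SeqOcc p → ℕ) →
         ∀ {p} → p ∈ q ∷ ps → SeqOcc p → ℕ
  (g ∷ᵖ gs) (here refl) = g
  (g ∷ᵖ gs) (there i)   = gs i

[]ᵖ : ∀ {p} → p ∈ [] → SeqOcc p → ℕ
[]ᵖ ()

-- From ranked sequents back to proofs

-- Ranked rules keep their principal formula in the premises, while the implication rules of G3s
-- drop it. The dropped copy counts as inverted, which is why the hypotheses are `AllLeft` and
-- `AllRight` rather than inclusions. Only rules common to the three systems occur, so `S` is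
-- arbitrary.
realise : ∀ {Γ Δ} → Γ ⊢ Δ → ∀ Fs Gs f g →
          AllLeft (ranks Fs f) (ranks Gs g) Γ → AllRight (ranks Fs f) (ranks Gs g) Δ →
          Realised S Fs Gs f g
realise (ax i j) Fs Gs f g l r with l i | r j
... | side i′ | side j′ with pull-∈ Fs f i′ | pull-∈ Gs g j′
... | pull {atom p} {Hs} σ refl s | pull {atom p} {Ks} τ refl t =
  infer (σ , τ) (ax Hs Ks p) [] , infer-Labelled []ᵖ (λ ()) (λ ()) tt
realise (⊥⊃ i) Fs Gs f g l r with l i
... | side i′ with pull-∈ Fs f i′
... | pull {⊥ᶠ} {Hs} σ refl s =
  infer (σ , refl) (⊥⊃ Hs Gs) [] , infer-Labelled []ᵖ (λ ()) (λ ()) tt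
realise (→⊃ i D E) Fs Gs f g l r with l i
... | ⊸₁ a = realise D Fs Gs f g l (a ∷ʳ r)
... | ⊸₂ b = realise E Fs Gs f g (b ∷ˡ l) r
... | side i′ with pull-∈ Fs f i′
... | pull {F ⇒ G} {Hs} σ refl s =
  infer (σ , refl) (→⊃ Hs Gs F G) (proj₁ d ∷ proj₁ e ∷ []) ,
  infer-Labelled ((f₁ ∣ g₁) ∷ᵖ (f₂ ∣ g) ∷ᵖ []ᵖ)
    (λ { (here refl) → proj₂ d ; (there (here refl)) → proj₂ e })
    (λ { (→⊃-side-ante₁ x) → refl ; (→⊃-side-succ₁ y) → refl ; (→⊃-active₁ o) → refl
       ; (→⊃-side-ante₂ x) → refl ; (→⊃-side-succ₂ y) → refl ; (→⊃-active₂ o) → refl })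
    tt
  where
  f′ = f ∘ Any-resp-↭ σ
  f₁ = f′ ∘ there
  g₁ = (λ o → f′ (here (left o))) ◂ g
  f₂ = (λ o → f′ (here (right o))) ◂ f₁
  -- In the first premise the principal implication is gone; it counts as inverted to `F`, now first
  -- in the succedent.
  l₁ : AllLeft (ranks Hs f₁) (ranks (F ∷ Gs) g₁) (ranks Fs f)
  l₁ = (⊸₁ (side (here refl)) ∷ˡ side) ∘ s
  l₂ : AllLeft (ranks (G ∷ Hs) f₂) (ranks Gs g) (ranks Fs f)
  l₂ = (⊸₂ (side (here refl)) ∷ˡ ⊆⇒AllLeft there) ∘ s
  d = realise D Hs (F ∷ Gs) f₁ g₁ (Left-bind l₁ (⊆⇒AllRight there) ∘ l)
        (side (here refl) ∷ʳ Right-bind l₁ (⊆⇒AllRight there) ∘ r)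
  e = realise E (G ∷ Hs) Gs f₂ g (side (here refl) ∷ˡ Left-bind l₂ side ∘ l)
        (Right-bind l₂ side ∘ r)
realise (⊃→ j D) Fs Gs f g l r with r j
... | a ⊸ b = realise D Fs Gs f g (a ∷ˡ l) (b ∷ʳ r)
... | side j′ with pull-∈ Gs g j′
... | pull {F ⇒ G} {Hs} τ refl t =
  infer (refl , τ) (⊃→ Fs Hs F G) (proj₁ d ∷ []) ,
  infer-Labelled ((f₁ ∣ g₁) ∷ᵖ []ᵖ) (λ { (here refl) → proj₂ d })
    (λ { (⊃→-side-ante x) → refl ; (⊃→-side-succ y) → refl
       ; (⊃→-active-ante o) → refl ; (⊃→-active-succ o) → refl })
    tt
  where
  g′ = g ∘ Any-resp-↭ τ
  f₁ = (λ o → g′ (here (left o))) ◂ f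
  g₁ = (λ o → g′ (here (right o))) ◂ g′ ∘ there
  r₁ : AllRight (ranks (F ∷ Fs) f₁) (ranks (G ∷ Hs) g₁) (ranks Gs g)
  r₁ = ((side (here refl) ⊸ side (here refl)) ∷ʳ ⊆⇒AllRight there) ∘ t
  d = realise D (F ∷ Fs) (G ∷ Hs) f₁ g₁
        (side (here refl) ∷ˡ Left-bind (⊆⇒AllLeft there) r₁ ∘ l)
        (side (here refl) ∷ʳ Right-bind (⊆⇒AllLeft there) r₁ ∘ r)
realise (□⊃ i D) Fs Gs f g l r with l i
... | side i′ with pull-∈ Fs f i′
... | pull {□ F} {Hs} σ refl s =
  infer (σ , refl) (□⊃ Hs Gs F) (proj₁ d ∷ []) ,
  infer-Labelled ((f₁ ∣ g) ∷ᵖ []ᵖ) (λ { (here refl) → proj₂ d })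
    (λ { (□⊃-side-ante x) → refl ; (□⊃-side-succ y) → refl
       ; (□⊃-active o) → refl ; (□⊃-active□ o) → refl })
    tt
  where
  f′ = f ∘ Any-resp-↭ σ
  f₁ = (λ o → f′ (here (under o))) ◂ f′
  l₁ : AllLeft (ranks (F ∷ □ F ∷ Hs) f₁) (ranks Gs g) (ranks Fs f)
  l₁ = ⊆⇒AllLeft (there ∘ s)
  d = realise D (F ∷ □ F ∷ Hs) Gs f₁ g (side (here refl) ∷ˡ Left-bind l₁ side ∘ l)
        (Right-bind l₁ side ∘ r)
realise (⊃□ {n} j u lo b D) Fs Gs f g l r with r j
... | side j′ with pull-∈ Gs g j′
... | pull {□ F} {Ks} τ refl t with boxes {Hs} {Bs} σ bd c ← select-boxes n Fs f =
  infer (σ , τ) (⊃□ Bs Hs Ks F) (proj₁ d ∷ []) ,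
  infer-Labelled ((f₁ ∣ g₁) ∷ᵖ []ᵖ) (λ { (here refl) → proj₂ d })
    (λ { (⊃□-side x) → refl ; (⊃□-active o) → refl })
    (λ { (ante x) → bd x ; (succ (here o)) → Below-rank⁻ F b o })
  where
  f₁ = f ∘ Any-resp-↭ σ ∘ ++⁺ʳ Hs
  g₁ = (λ o → g (Any-resp-↭ τ (here (under o)))) ◂ λ ()
  d = realise D (map □_ Bs) (F ∷ []) f₁ g₁
        (λ i → let lw = All.lookup lo i in side (c (Left-boxed (proj₁ lw) (l (u i))) lw))
        (side (here refl) ∷ʳ λ ())

-- From labelled proofs to ranked sequents

module _ {ps c s} {σ : c ≋ s} {r : Rule S ps c} {ds : All (Proof S) ps} {h}
         (L : Labelled (infer σ r ds) h) where

  -- `g` restates the labels of the premise in terms of those of the conclusion, so that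
  -- corresponding formulas become equal ranked formulas.
  premise-Labelled : ∀ {p} (i : p ∈ ps) (g : SeqOcc p → ℕ) →
    (∀ o → label L (above i (root o)) ≡ g o) → Labelled (All.lookup ds i) g
  premise-Labelled i g e = record
    { label  = label L ∘ above i
    ; root-≡ = e
    ; resp   = resp L ∘ above
    ; mono   = mono L ∘ above
    }

  label-≡ : ∀ {p} {i : p ∈ ps} {o o′} → Direct r (premise i o) (concl o′) →
            label L (above i (root o)) ≡ h (transport σ o′)
  label-≡ D = ≡.trans (resp L (last-rule D)) (root-≡ L _)

-- Rule by rule, with both cuts discharged by admissibility. Inside `last`, `weaken` puts back the
-- principal formula, which ranked rules keep in their premises.
derive : (d : Proof S (Fs ⊃ Gs)) → ∀ {h} → Labelled d h →
         ranks Fs (h ∘ ante) ⊢ ranks Gs (h ∘ succ)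
derive (infer (σ , τ) r ds) {h} L =
  weaken (ranks-↭ σ (h ∘ ante)) (ranks-↭ τ (h ∘ succ)) (last r ds L)
  where
  f = h ∘ ante ∘ Any-resp-↭ σ
  g = h ∘ succ ∘ Any-resp-↭ τ
  last : ∀ {ps} (r : Rule _ ps _) (ds : All (Proof _) ps) → Labelled (infer (σ , τ) r ds) h →
         ranks _ f ⊢ ranks _ g
  last (ax Γ Δ p) [] L = ax (here refl) (here refl)
  last (⊥⊃ Γ Δ) [] L = ⊥⊃ (here refl)
  last (→⊃ Γ Δ A B) (d ∷ e ∷ []) L = →⊃ (here refl)
    (weaken there id (derive d (premise-Labelled L (here refl)
      ((f ∘ there) ∣ ((λ o → f (here (left o))) ◂ g))
      λ { (ante x) → label-≡ L (→⊃-side-ante₁ x)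
        ; (succ (here o)) → label-≡ L (→⊃-active₁ o)
        ; (succ (there y)) → label-≡ L (→⊃-side-succ₁ y) })))
    (weaken (∷⁺ʳ _ there) id (derive e (premise-Labelled L (there (here refl))
      (((λ o → f (here (right o))) ◂ f ∘ there) ∣ g)
      λ { (ante (here o))  → label-≡ L (→⊃-active₂ o)
        ; (ante (there x)) → label-≡ L (→⊃-side-ante₂ x)
        ; (succ y)         → label-≡ L (→⊃-side-succ₂ y) })))
  last (⊃→ Γ Δ A B) (d ∷ []) L = ⊃→ (here refl)
    (weaken id (∷⁺ʳ _ there) (derive d (premise-Labelled L (here refl)
      (((λ o → f′ (left o)) ◂ f) ∣ ((λ o → f′ (right o)) ◂ g ∘ there))
      λ { (ante (here o))  → label-≡ L (⊃→-active-ante o)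
        ; (ante (there x)) → label-≡ L (⊃→-side-ante x)
        ; (succ (here o))  → label-≡ L (⊃→-active-succ o)
        ; (succ (there y)) → label-≡ L (⊃→-side-succ y) })))
    where f′ = λ o → g (here o)
  last (□⊃ Γ Δ A) (d ∷ []) L = □⊃ (here refl)
    (derive d (premise-Labelled L (here refl)
      (((λ o → f (here (under o))) ◂ f) ∣ g)
      λ { (ante (here o))          → label-≡ L (□⊃-active o)
        ; (ante (there (here o)))  → label-≡ L (□⊃-active□ o)
        ; (ante (there (there x))) → label-≡ L (□⊃-side-ante x)
        ; (succ y)                 → label-≡ L (□⊃-side-succ y) }))
  last (⊃□ Γ Γ′ Δ′ A) (d ∷ []) L = ⊃□ (here refl) (ranks-++ʳ Γ′ f)
    (Below□-ranks Γ λ x → increasing (ante x) (label-≡ L (⊃□-side x)))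
    (Below-rank A λ o → increasing (succ (here o)) (label-≡ L (⊃□-active o)))
    (derive d (premise-Labelled L (here refl)
      ((f ∘ ++⁺ʳ Γ′) ∣ ((λ o → g (here (under o))) ◂ λ ()))
      λ { (ante x)        → label-≡ L (⊃□-side x)
        ; (succ (here o)) → label-≡ L (⊃□-active o) }))
    where
    increasing : ∀ o {m} → label L (above (here refl) (root o)) ≡ m → m < g (here outer)
    increasing o e = subst₂ _<_ e (root-≡ L _) (mono L (last-rule o))
  last (cut Γ Δ A) (d ∷ e ∷ []) L = cut-admissible (rank A a)
    (derive d (premise-Labelled L (here refl) (f ∣ (a ◂ g))
      λ { (ante x)         → label-≡ L (cut-side-ante₁ x)
        ; (succ (here o))  → refl
        ; (succ (there y)) → label-≡ L (cut-side-succ₁ y) }))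
    (derive e (premise-Labelled L (there (here refl)) ((a ◂ f) ∣ g)
      λ { (ante (here o))  → sym (resp L (last-rule (cut-active o)))
        ; (ante (there x)) → label-≡ L (cut-side-ante₂ x)
        ; (succ y)         → label-≡ L (cut-side-succ₂ y) }))
    where
    -- The cut formula is missing from the conclusion, so its ranks are read off in the first
    -- premise; `cut-active` carries them to the second.
    a : □Occ A → ℕ
    a o = label L (above (here refl) (root (succ (here o))))
  last (□cut Γ Δ A B) (d ∷ e ∷ []) L = □cut-admissible (rank A a) (rank B b) (here refl)
    (derive d (premise-Labelled L (here refl) (f ∣ (a□ ◂ g))
      λ { (ante x)                → label-≡ L (□cut-side-ante₁ x)
        ; (succ (here outer))     → label-≡ L □cut-outer₁
        ; (succ (here (under o))) → refl
        ; (succ (there (here o))) → label-≡ L (□cut-□B₁ o)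
        ; (succ (there (there y))) → label-≡ L (□cut-side-succ₁ y) }))
    (derive e (premise-Labelled L (there (here refl)) (f ∣ (ab□ ◂ g))
      λ { (ante x)                        → label-≡ L (□cut-side-ante₂ x)
        ; (succ (here outer))             → label-≡ L □cut-outer₂
        ; (succ (here (under (left o))))  → sym (resp L (last-rule (□cut-A o)))
        ; (succ (here (under (right o)))) → label-≡ L (□cut-B o)
        ; (succ (there (here o)))         → label-≡ L (□cut-□B₂ o)
        ; (succ (there (there y)))        → label-≡ L (□cut-side-succ₂ y) }))
    where
    -- Only `A` is missing from the conclusion; the ranks of `B` and of the outer □ come from □B
    -- there.
    a : □Occ A → ℕ
    a o = label L (above (here refl) (root (succ (here (under o)))))
    b : □Occ B → ℕ
    b o = g (here (under o))
    a□ : □Occ (□ A) → ℕ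
    a□ outer     = g (here outer)
    a□ (under o) = a o
    ab□ : □Occ (□ (A ⇒ B)) → ℕ
    ab□ outer             = g (here outer)
    ab□ (under (left o))  = a o
    ab□ (under (right o)) = b o

-- Ranking the families of a cycle-free proof

module Digraph {V : Set} (_≟_ : DecidableEquality V) where

  Edges : Set
  Edges = List (V × V)

  Path : Edges → V → V → Set
  Path es = Star (λ x y → (x , y) ∈ es)

  -- The part before the first use of the new edge and the part after its last use suffice.
  -- Reachability thereby becomes decidable by recursion on the list of edges.
  through : ∀ {es a b x y} → Path ((a , b) ∷ es) x y →
            Path es x y ⊎ (Path es x a × Path es b y)
  through ε = inj₁ ε
  through (here refl ◅ p) with through p
  ... | inj₁ q       = inj₂ (ε , q)
  ... | inj₂ (_ , q) = inj₂ (ε , q)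
  through (there i ◅ p) with through p
  ... | inj₁ q       = inj₁ (i ◅ q)
  ... | inj₂ (q , r) = inj₂ (i ◅ q , r)

  path? : ∀ es → Decidable (Path es)
  path? [] x y = map′ (λ { refl → ε }) (λ { ε → refl }) (x ≟ y)
  path? ((a , b) ∷ es) x y =
    map′ [ Star.map there , (λ { (p , q) → Star.map there p ◅◅ here refl ◅ Star.map there q }) ]′
         through
         (path? es x y ⊎-dec (path? es x a ×-dec path? es b y))

  -- The edges in ws are to be weakly increasing, those in ss strictly.
  StrictCycle : Edges → Edges → Set
  StrictCycle ws ss = ∃[ a ] ∃[ b ] (a , b) ∈ ss × Path (ss ++ ws) b a

  Ranking : Edges → Edges → Set
  Ranking ws ss = Σ[ ℓ ∈ (V → ℕ) ]
    (∀ {x y} → (x , y) ∈ ws → ℓ x ≤ ℓ y) × (∀ {x y} → (x , y) ∈ ss → ℓ x < ℓ y)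

  private
    raise : {P : Set} → ℕ → Dec P → ℕ → ℕ
    -- `k` will be the rank of the source of the new edge: `suc k` lifts even rank 0 above it, and
    -- adding a constant preserves the order among raised vertices.
    raise k (yes _) n = suc k + n
    raise k (no _)  n = n

    module _ {P Q : Set} (k : ℕ) (P⇒Q : P → Q) where

      -- `P` and `Q` say that the source and the target of an old edge are reachable from the target
      -- of the new one. Reachability passes along edges, so the source is never raised alone.
      raise-≤ : ∀ (p? : Dec P) (q? : Dec Q) {m n} → m ≤ n → raise k p? m ≤ raise k q? n
      raise-≤ (yes _) (yes _)  m≤n = +-monoʳ-≤ (suc k) m≤n
      raise-≤ (yes p) (no ¬q)  m≤n = contradiction (P⇒Q p) ¬q
      raise-≤ (no _)  (yes _)  m≤n = ≤-trans m≤n (m≤n+m _ (suc k))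
      raise-≤ (no _)  (no _)   m≤n = m≤n

      raise-< : ∀ (p? : Dec P) (q? : Dec Q) {m n} → m < n → raise k p? m < raise k q? n
      raise-< (yes _) (yes _)  m<n = +-monoʳ-< (suc k) m<n
      raise-< (yes p) (no ¬q)  m<n = contradiction (P⇒Q p) ¬q
      raise-< (no _)  (yes _)  m<n = <-≤-trans m<n (m≤n+m _ (suc k))
      raise-< (no _)  (no _)   m<n = m<n

    raise-new : ∀ {P Q : Set} (p? : Dec P) (q? : Dec Q) {k n} → ¬ P → Q →
                raise k p? k < raise k q? n
    raise-new (yes p) _       ¬p q = contradiction p ¬p
    raise-new (no _)  (no ¬q) ¬p q = contradiction q ¬q
    raise-new (no _)  (yes _) ¬p q = s≤s (m≤m+n _ _)

  -- A new strict edge from a to b is accommodated by raising all that is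
  -- reachable from b above a; as a is not reachable from b, its rank stays.
  ranking : ∀ ws ss → ¬ StrictCycle ws ss → Ranking ws ss
  ranking ws [] acyclic = (λ _ → 0) , (λ _ → z≤n) , λ ()
  ranking ws ((a , b) ∷ ss) acyclic
    with ℓ , ≤-ws , <-ss ← ranking ws ss
           (λ (x , y , i , p) → acyclic (x , y , there i , Star.map there p)) =
    ℓ′ ,
    (λ i → raise-≤ (ℓ a) (λ p → p ◅◅ ∈-++⁺ʳ ss i ◅ ε) (b ⇝? _) (b ⇝? _) (≤-ws i)) ,
    λ { (here refl) → raise-new (b ⇝? a) (b ⇝? b)
                        (λ p → acyclic (a , b , here refl , Star.map there p)) ε
      ; (there i)   → raise-< (ℓ a) (λ p → p ◅◅ ∈-++⁺ˡ i ◅ ε) (b ⇝? _) (b ⇝? _) (<-ss i) }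
    where
    _⇝?_ = path? (ss ++ ws)
    ℓ′ : V → ℕ
    ℓ′ x = raise (ℓ a) (b ⇝? x) (ℓ x)

-- Finiteness of the two relations on a proof

Finite : Set → Set
Finite I = Σ[ xs ∈ List I ] (∀ x → x ∈ xs)

finite-∅ : ¬ I → Finite I
finite-∅ ¬a = [] , λ a → contradiction a ¬a

finite-⊤ : Finite ⊤
finite-⊤ = tt ∷ [] , λ _ → here refl

finite-image : (f : I → J) → (∀ b → ∃[ a ] f a ≡ b) → Finite I → Finite J
finite-image f surj (xs , all) = map f xs , complete
  where
  complete : ∀ b → b ∈ map f xs
  complete b with a , refl ← surj b = ∈-map⁺ f (all a)

infixr 1 _⊎-finite_
_⊎-finite_ : Finite I → Finite J → Finite (I ⊎ J)
(xs , all-xs) ⊎-finite (ys , all-ys) = map inj₁ xs ++ map inj₂ ys ,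
  λ { (inj₁ x) → ∈-++⁺ˡ (∈-map⁺ inj₁ (all-xs x))
    ; (inj₂ y) → ∈-++⁺ʳ (map inj₁ xs) (∈-map⁺ inj₂ (all-ys y)) }

finite-□Occ : ∀ F → Finite (□Occ F)
finite-□Occ ⊥ᶠ       = finite-∅ λ ()
finite-□Occ (atom p) = finite-∅ λ ()
finite-□Occ (F ⇒ G)  = finite-image [ left , right ]′
  (λ { (left o) → inj₁ o , refl ; (right o) → inj₂ o , refl })
  (finite-□Occ F ⊎-finite finite-□Occ G)
finite-□Occ (□ F)    = finite-image [ (λ _ → outer) , under ]′
  (λ { outer → inj₁ tt , refl ; (under o) → inj₂ o , refl })
  (finite-⊤ ⊎-finite finite-□Occ F)

finite-Any : ∀ Fs → Finite (Any □Occ Fs)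
finite-Any []       = finite-∅ λ ()
finite-Any (F ∷ Fs) = finite-image [ here , there ]′
  (λ { (here o) → inj₁ o , refl ; (there x) → inj₂ x , refl })
  (finite-□Occ F ⊎-finite finite-Any Fs)

finite-SeqOcc : ∀ s → Finite (SeqOcc s)
finite-SeqOcc (Γ ⊃ Δ) = finite-image [ ante , succ ]′
  (λ { (ante x) → inj₁ x , refl ; (succ y) → inj₂ y , refl })
  (finite-Any Γ ⊎-finite finite-Any Δ)

-- Pairs are listed together with their witnesses, so that an edge found in the list gives back a
-- proof of `R`.
Graph : (I → I → Set) → Set
Graph R = ∃[ xy ] uncurry R xy

finite-Direct : ∀ {ps c} (r : Rule S ps c) → Finite (Graph (Direct r))
finite-Direct (ax Γ Δ p) = finite-∅ λ ()
finite-Direct (⊥⊃ Γ Δ)   = finite-∅ λ ()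
finite-Direct (→⊃ Γ Δ A B) = finite-image
  [ (λ x → _ , →⊃-side-ante₁ x) , [ (λ y → _ , →⊃-side-succ₁ y) , [ (λ o → _ , →⊃-active₁ o) ,
  [ (λ x → _ , →⊃-side-ante₂ x) , [ (λ y → _ , →⊃-side-succ₂ y) , (λ o → _ , →⊃-active₂ o)
  ]′ ]′ ]′ ]′ ]′
  (λ { (_ , →⊃-side-ante₁ x) → inj₁ x , refl
     ; (_ , →⊃-side-succ₁ y) → inj₂ (inj₁ y) , refl
     ; (_ , →⊃-active₁ o)    → inj₂ (inj₂ (inj₁ o)) , refl
     ; (_ , →⊃-side-ante₂ x) → inj₂ (inj₂ (inj₂ (inj₁ x))) , refl
     ; (_ , →⊃-side-succ₂ y) → inj₂ (inj₂ (inj₂ (inj₂ (inj₁ y)))) , refl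
     ; (_ , →⊃-active₂ o)    → inj₂ (inj₂ (inj₂ (inj₂ (inj₂ o)))) , refl })
  (finite-Any Γ ⊎-finite finite-Any Δ ⊎-finite finite-□Occ A ⊎-finite
   finite-Any Γ ⊎-finite finite-Any Δ ⊎-finite finite-□Occ B)
finite-Direct (⊃→ Γ Δ A B) = finite-image
  [ (λ x → _ , ⊃→-side-ante x) , [ (λ y → _ , ⊃→-side-succ y) ,
  [ (λ o → _ , ⊃→-active-ante o) , (λ o → _ , ⊃→-active-succ o) ]′ ]′ ]′
  (λ { (_ , ⊃→-side-ante x)   → inj₁ x , refl
     ; (_ , ⊃→-side-succ y)   → inj₂ (inj₁ y) , refl
     ; (_ , ⊃→-active-ante o) → inj₂ (inj₂ (inj₁ o)) , refl
     ; (_ , ⊃→-active-succ o) → inj₂ (inj₂ (inj₂ o)) , refl })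
  (finite-Any Γ ⊎-finite finite-Any Δ ⊎-finite finite-□Occ A ⊎-finite finite-□Occ B)
finite-Direct (□⊃ Γ Δ A) = finite-image
  [ (λ x → _ , □⊃-side-ante x) , [ (λ y → _ , □⊃-side-succ y) ,
  [ (λ o → _ , □⊃-active o) , (λ o → _ , □⊃-active□ o) ]′ ]′ ]′
  (λ { (_ , □⊃-side-ante x) → inj₁ x , refl
     ; (_ , □⊃-side-succ y) → inj₂ (inj₁ y) , refl
     ; (_ , □⊃-active o)    → inj₂ (inj₂ (inj₁ o)) , refl
     ; (_ , □⊃-active□ o)   → inj₂ (inj₂ (inj₂ o)) , refl })
  (finite-Any Γ ⊎-finite finite-Any Δ ⊎-finite finite-□Occ A ⊎-finite finite-□Occ (□ A))
finite-Direct (⊃□ Γ Γ′ Δ′ A) = finite-image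
  [ (λ x → _ , ⊃□-side x) , (λ o → _ , ⊃□-active o) ]′
  (λ { (_ , ⊃□-side x) → inj₁ x , refl ; (_ , ⊃□-active o) → inj₂ o , refl })
  (finite-Any (map □_ Γ) ⊎-finite finite-□Occ A)
finite-Direct (cut Γ Δ A) = finite-image
  [ (λ x → _ , cut-side-ante₁ x) , [ (λ y → _ , cut-side-succ₁ y) ,
  [ (λ x → _ , cut-side-ante₂ x) , [ (λ y → _ , cut-side-succ₂ y) , (λ o → _ , cut-active o)
  ]′ ]′ ]′ ]′
  (λ { (_ , cut-side-ante₁ x) → inj₁ x , refl
     ; (_ , cut-side-succ₁ y) → inj₂ (inj₁ y) , refl
     ; (_ , cut-side-ante₂ x) → inj₂ (inj₂ (inj₁ x)) , refl
     ; (_ , cut-side-succ₂ y) → inj₂ (inj₂ (inj₂ (inj₁ y))) , refl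
     ; (_ , cut-active o)     → inj₂ (inj₂ (inj₂ (inj₂ o))) , refl })
  (finite-Any Γ ⊎-finite finite-Any Δ ⊎-finite finite-Any Γ ⊎-finite finite-Any Δ ⊎-finite
   finite-□Occ A)
finite-Direct (□cut Γ Δ A B) = finite-image
  [ (λ x → _ , □cut-side-ante₁ x) , [ (λ y → _ , □cut-side-succ₁ y) ,
  [ (λ x → _ , □cut-side-ante₂ x) , [ (λ y → _ , □cut-side-succ₂ y) ,
  [ (λ o → _ , □cut-□B₁ o) , [ (λ o → _ , □cut-□B₂ o) ,
  [ (λ _ → _ , □cut-outer₁) , [ (λ _ → _ , □cut-outer₂) ,
  [ (λ o → _ , □cut-A o) , (λ o → _ , □cut-B o)
  ]′ ]′ ]′ ]′ ]′ ]′ ]′ ]′ ]′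
  (λ { (_ , □cut-side-ante₁ x) → inj₁ x , refl
     ; (_ , □cut-side-succ₁ y) → inj₂ (inj₁ y) , refl
     ; (_ , □cut-side-ante₂ x) → inj₂ (inj₂ (inj₁ x)) , refl
     ; (_ , □cut-side-succ₂ y) → inj₂ (inj₂ (inj₂ (inj₁ y))) , refl
     ; (_ , □cut-□B₁ o)  → inj₂ (inj₂ (inj₂ (inj₂ (inj₁ o)))) , refl
     ; (_ , □cut-□B₂ o)  → inj₂ (inj₂ (inj₂ (inj₂ (inj₂ (inj₁ o))))) , refl
     ; (_ , □cut-outer₁) → inj₂ (inj₂ (inj₂ (inj₂ (inj₂ (inj₂ (inj₁ tt)))))) , refl
     ; (_ , □cut-outer₂) → inj₂ (inj₂ (inj₂ (inj₂ (inj₂ (inj₂ (inj₂ (inj₁ tt))))))) , refl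
     ; (_ , □cut-A o) → inj₂ (inj₂ (inj₂ (inj₂ (inj₂ (inj₂ (inj₂ (inj₂ (inj₁ o)))))))) , refl
     ; (_ , □cut-B o) → inj₂ (inj₂ (inj₂ (inj₂ (inj₂ (inj₂ (inj₂ (inj₂ (inj₂ o)))))))) , refl })
  (finite-Any Γ ⊎-finite finite-Any Δ ⊎-finite finite-Any Γ ⊎-finite finite-Any Δ ⊎-finite
   finite-□Occ (□ B) ⊎-finite finite-□Occ (□ B) ⊎-finite finite-⊤ ⊎-finite finite-⊤ ⊎-finite
   finite-□Occ A ⊎-finite finite-□Occ B)

InPremise : (∀ {s} → Proof S s → Set) → ∀ {ps} → All (Proof S) ps → Set
InPremise T {ps} ds = ∃[ p ] Σ[ i ∈ p ∈ ps ] T (All.lookup ds i)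

module _ (T : ∀ {s} → Proof S s → Set)
  (step : ∀ {ps c s} (σ : c ≋ s) (r : Rule S ps c) (ds : All (Proof S) ps) →
          Finite (InPremise T ds) → Finite (T (infer σ r ds))) where

  mutual
    -- Common recursion for both relations: their pairs come from the last rule, treated by `step`,
    -- or from a premise.
    finite-Proof : ∀ {s} (d : Proof S s) → Finite (T d)
    finite-Proof (infer σ r ds) = step σ r ds (finite-InPremise ds)

    finite-InPremise : ∀ {ps} (ds : All (Proof S) ps) → Finite (InPremise T ds)
    finite-InPremise []       = finite-∅ λ ()
    finite-InPremise (d ∷ ds) = finite-image
      [ (λ t → _ , here refl , t) , (λ { (_ , i , t) → _ , there i , t }) ]′
      (λ { (_ , here refl , t) → inj₁ t , refl ; (_ , there i , t) → inj₂ (_ , i , t) , refl })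
      (finite-Proof d ⊎-finite finite-InPremise ds)

finite-DirectlyCorresponds : ∀ {s} (d : Proof S s) → Finite (Graph (DirectlyCorresponds {d = d}))
finite-DirectlyCorresponds = finite-Proof (λ d → Graph (DirectlyCorresponds {d = d})) λ σ r ds fin →
  finite-image
  [ (λ { (_ , D) → _ , last-rule D }) , (λ { (_ , i , _ , D) → _ , above {i = i} D }) ]′
  (λ { (_ , last-rule D) → inj₁ (_ , D) , refl ; (_ , above D) → inj₂ (_ , _ , _ , D) , refl })
  (finite-Direct r ⊎-finite fin)

-- Indexes the pairs that the last rule adds to `BoxIntro`: one for each □ in the premise of a (⊃□).
IntroPremise : ∀ {ps c} → Rule S ps c → Set
IntroPremise (⊃□ Γ Γ′ Δ′ A) = SeqOcc (map □_ Γ ⊃ A ∷ [])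
IntroPremise _              = ⊥

finite-IntroPremise : ∀ {ps c} (r : Rule S ps c) → Finite (IntroPremise r)
finite-IntroPremise (ax Γ Δ p)     = finite-∅ id
finite-IntroPremise (⊥⊃ Γ Δ)       = finite-∅ id
finite-IntroPremise (→⊃ Γ Δ A B)   = finite-∅ id
finite-IntroPremise (⊃→ Γ Δ A B)   = finite-∅ id
finite-IntroPremise (□⊃ Γ Δ A)     = finite-∅ id
finite-IntroPremise (⊃□ Γ Γ′ Δ′ A) = finite-SeqOcc _
finite-IntroPremise (cut Γ Δ A)    = finite-∅ id
finite-IntroPremise (□cut Γ Δ A B) = finite-∅ id

finite-BoxIntro : ∀ {s} (d : Proof S s) → Finite (Graph (BoxIntro {d = d}))
finite-BoxIntro = finite-Proof (λ d → Graph (BoxIntro {d = d})) λ σ r ds fin →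
  finite-image
  [ intro r , (λ { (_ , i , _ , b) → _ , above {i = i} b }) ]′
  (λ { (_ , last-rule o) → inj₁ o , refl ; (_ , above b) → inj₂ (_ , _ , _ , b) , refl })
  (finite-IntroPremise r ⊎-finite fin)
  where
  intro : ∀ {ps c s} {σ : c ≋ s} (r : Rule S ps c) {ds : All (Proof S) ps} →
          IntroPremise r → Graph (BoxIntro {d = infer σ r ds})
  intro (⊃□ Γ Γ′ Δ′ A) o = _ , last-rule o

-- Decidable equality of occurrences

_≟□_ : ∀ {F} → DecidableEquality (□Occ F)
outer   ≟□ outer   = yes refl
outer   ≟□ under _ = no λ ()
under _ ≟□ outer   = no λ ()
under o ≟□ under o′ = map′ (cong under) (λ { refl → refl }) (o ≟□ o′)
left o  ≟□ left o′  = map′ (cong left) (λ { refl → refl }) (o ≟□ o′)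
left _  ≟□ right _  = no λ ()
right _ ≟□ left _   = no λ ()
right o ≟□ right o′ = map′ (cong right) (λ { refl → refl }) (o ≟□ o′)

_≟ᴬ_ : ∀ {Fs} → DecidableEquality (Any □Occ Fs)
here o  ≟ᴬ here o′  = map′ (cong here) (λ { refl → refl }) (o ≟□ o′)
here _  ≟ᴬ there _  = no λ ()
there _ ≟ᴬ here _   = no λ ()
there x ≟ᴬ there x′ = map′ (cong there) (λ { refl → refl }) (x ≟ᴬ x′)

_≟ˢ_ : ∀ {s} → DecidableEquality (SeqOcc s)
ante x ≟ˢ ante x′ = map′ (cong ante) (λ { refl → refl }) (x ≟ᴬ x′)
ante _ ≟ˢ succ _  = no λ ()
succ _ ≟ˢ ante _  = no λ ()
succ y ≟ˢ succ y′ = map′ (cong succ) (λ { refl → refl }) (y ≟ᴬ y′)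

-- The sequents `p` and `q` may differ, so positions are compared as dependent pairs; equality then
-- makes the occurrences above them comparable.
same-position? : ∀ {ps : List Sequent} {p q} (i : p ∈ ps) (j : q ∈ ps) →
                 Dec (_≡_ {A = ∃[ p ] p ∈ ps} (p , i) (q , j))
same-position? (here refl) (here refl) = yes refl
same-position? (here _)    (there _)   = no λ ()
same-position? (there _)   (here _)    = no λ ()
same-position? (there i)   (there j)   =
  map′ (λ { refl → refl }) (λ { refl → refl }) (same-position? i j)

_≟ᴼ_ : ∀ {s} {d : Proof S s} → DecidableEquality (Occ d)
root o    ≟ᴼ root o′    = map′ (cong root) (λ { refl → refl }) (o ≟ˢ o′)
root _    ≟ᴼ above _ _  = no λ ()
above _ _ ≟ᴼ root _     = no λ ()
above i o ≟ᴼ above j o′ with same-position? i j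
... | no i≢j   = no λ { refl → i≢j refl }
... | yes refl = map′ (cong (above i)) (λ { refl → refl }) (o ≟ᴼ o′)

-- From cycle-free proofs to labellings

module _ {s} (d : Proof S s) (cycleFree : CycleFree d) where

  private
    open Digraph (_≟ᴼ_ {d = d})

    edges : ∀ {R : Occ d → Occ d → Set} → Finite (Graph R) → Edges
    edges fin = map proj₁ (proj₁ fin)

    edges⁺ : ∀ {R : Occ d → Occ d → Set} (fin : Finite (Graph R)) {o o′} →
             R o o′ → (o , o′) ∈ edges fin
    edges⁺ fin r = ∈-map⁺ proj₁ (proj₂ fin (_ , r))

    edges⁻ : ∀ {R : Occ d → Occ d → Set} (fin : Finite (Graph R)) {o o′} →
             (o , o′) ∈ edges fin → R o o′
    edges⁻ fin i with (_ , r) , _ , refl ← ∈-map⁻ proj₁ i = r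

    correspondences weak strict : Edges
    correspondences = edges (finite-DirectlyCorresponds d)
    -- Each correspondence enters in both directions, which forces equal ranks.
    weak            = correspondences ++ map Product.swap correspondences
    strict          = edges (finite-BoxIntro d)

    weak⁻ : ∀ {o o′} → (o , o′) ∈ weak → SymClosure DirectlyCorresponds o o′
    weak⁻ i with ∈-++⁻ correspondences i
    ... | inj₁ j = fwd (edges⁻ (finite-DirectlyCorresponds d) j)
    ... | inj₂ j with _ , k , refl ← ∈-map⁻ Product.swap j =
      bwd (edges⁻ (finite-DirectlyCorresponds d) k)

    absorb : ∀ {i j k} → TransClosure (Prehistoric d) i j → SymClosure DirectlyCorresponds j k →
             TransClosure (Prehistoric d) i k
    absorb [ _ , _ , c , b , c′ ] e = [ _ , _ , c , b , c′ ◅◅ e ◅ ε ]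
    absorb (p ∷ ps)               e = p ∷ absorb ps e

    -- Starting from a nonempty chain, strict edges add links and weak edges are absorbed into the
    -- last link, so a strict cycle of the graph yields a prehistoric cycle.
    follow : ∀ {i j k} → TransClosure (Prehistoric d) i j → Path (strict ++ weak) j k →
             TransClosure (Prehistoric d) i k
    follow c ε       = c
    follow c (e ◅ p) with ∈-++⁻ strict e
    ... | inj₁ b = follow (c Plus.∷ʳ (_ , _ , ε , edges⁻ (finite-BoxIntro d) b , ε)) p
    ... | inj₂ w = follow (absorb c (weak⁻ w)) p

    acyclic : ¬ StrictCycle weak strict
    acyclic (o , _ , b , p) =
      cycleFree (o , follow [ _ , _ , ε , edges⁻ (finite-BoxIntro d) b , ε ] p)

  CycleFree⇒Labelled : ∃[ h ] Labelled d h
  CycleFree⇒Labelled with ℓ , ≤-weak , <-strict ← ranking weak strict acyclic = ℓ ∘ root , record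
    { label  = ℓ
    ; root-≡ = λ _ → refl
    ; resp   = λ D → let i = edges⁺ (finite-DirectlyCorresponds d) D in
                     ≤-antisym (≤-weak (∈-++⁺ˡ i))
                               (≤-weak (∈-++⁺ʳ correspondences (∈-map⁺ Product.swap i)))
    ; mono   = <-strict ∘ edges⁺ (finite-BoxIntro d)
    }

-- The labels of the end sequent survive the passage: they rank the sequent derived from `d`, and
-- the new proof `e` is labelled with the same `h`, which excludes cycles.
transfer : ∀ {S T s} → CycleFreeFragment S s → CycleFreeFragment T s
transfer {s = Γ ⊃ Δ} (d , cf)
  with h , L ← CycleFree⇒Labelled d cf
  with e , M ← realise (derive d L) Γ Δ (h ∘ ante) (h ∘ succ) side side =
  e , Labelled⇒CycleFree M

mainTheorem6 : (CycleFreeFragment G3s+□Cut ≐ CycleFreeFragment G3s+Cut) ×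
    (CycleFreeFragment G3s+Cut ≐ CycleFreeFragment G3s) ×
    (CycleFreeFragment G3s+□Cut ≐ CycleFreeFragment G3s)
mainTheorem6 = (transfer , transfer) , (transfer , transfer) , (transfer , transfer)
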